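{- For every $n\ge1$, the number $\mathrm{ILF}_n^2$ of forests $F=(F_1,\ldots,F_n)$ of $n$ binary shrubs with label set $\{1,\ldots,3n\}$ satisfying $F_1<_L F_2<_L\cdots<_L F_n$ equals $$\mathrm{ILF}_n^2=\frac{4^n\,(3n)!}{(n+1)!\,(2n+1)!}.$$
   Context: A binary shrub is a root with an ordered pair of children (left, right), labeled by distinct positive integers with the root's label smaller than both children's labels; its word is (root label, left child label, right child label). A forest of $n$ binary shrubs with label set $\{1,\ldots,3n\}$ is an ordered sequence of $n$ binary shrubs whose labels together are exactly $\{1,\ldots,3n\}$, each used once. For shrubs with words $abc$ and $def$, $abc<_L def$ means $a<d$, $b<e$ and $c<f$. -}

module Defs where

open import Data.Nat using (ℕ; suc; _+_; _*_; _<_; _≤_)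
open import Data.Product using (_×_; _,_)
open import Data.List using (List; []; _∷_; _++_)
open import Data.List.Membership.Propositional using (_∈_)
open import Data.List.Relation.Unary.Unique.Propositional using (Unique)
open import Data.Unit using (⊤)
open import Data.Vec using (Vec; []; _∷_)

-- A binary shrub, given by its word (root label, left child label, right child label).
Shrub : Set
Shrub = ℕ × ℕ × ℕ

IsShrub : Shrub → Set
IsShrub (a , b , c) = (a < b) × (a < c)

_<L_ : Shrub → Shrub → Set
(a , b , c) <L (d , e , f) = (a < d) × (b < e) × (c < f)

Forest : ℕ → Set
Forest n = Vec Shrub n

AllShrubs : ∀ {n} → Forest n → Set
AllShrubs [] = ⊤
AllShrubs (s ∷ F) = IsShrub s × AllShrubs F

data Increasing : ∀ {n} → Forest n → Set where
  inc-[] : Increasing []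
  inc-[-] : ∀ {s} → Increasing (s ∷ [])
  inc-∷ : ∀ {n s t} {F : Forest n} →
          s <L t → Increasing (t ∷ F) → Increasing (s ∷ t ∷ F)

labels : ∀ {n} → Forest n → List ℕ
labels [] = []
labels ((a , b , c) ∷ F) = a ∷ b ∷ c ∷ labels F

HasLabelSet : ∀ {n} → ℕ → Forest n → Set
HasLabelSet m F =
  Unique (labels F) ×
  (∀ k → k ∈ labels F → (1 ≤ k) × (k ≤ m)) ×
  (∀ k → 1 ≤ k → k ≤ m → k ∈ labels F)

IsILF : (n : ℕ) → Forest n → Set
IsILF n F = AllShrubs F × HasLabelSet (3 * n) F × Increasing F

{-# OPTIONS --safe #-}
-- Reading the labels 1, …, 3n in order, with a, b, c for a root, a left and a right child, turns an
-- increasing forest into a Kreweras excursion: a quadrant walk with steps a = (1,1), b = (-1,0),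
-- c = (0,-1) from the origin to itself.  Let Q(x,y) count all quadrant walks by length (t) and endpoint,
-- and let T = 1 + 4t³T³, q = 2t³T³, c = 1 + xt²T²c² and R(x) = Tc(1 - qc).  Then
--   R = 1 + 2t(R - R(0))/x + t²xR²,
-- and with h = (xR(x) - yR(y))/(x - y) the series h/(1 - txyh) satisfies the kernel equation that
-- characterises Q; hence Q(0,0) = R(0) = T - 2t³T⁴, whose coefficients are Fuss–Catalan numbers.
module Submission where

open import Defs
open import Algebra.Bundles using (CommutativeRing; Semiring)
open import Algebra.Morphism.Structures using (IsSemiringHomomorphism)
open import Data.Nat.Base as ℕ using (ℕ; zero; suc; _≤_; z≤n; s≤s)
import Data.Nat.Properties as ℕₚ
open import Data.Product using (Σ; ∃; _×_; _,_; proj₁; proj₂)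
open import Function.Base using (_∘_; flip)
open import Level using (0ℓ)
open import Relation.Binary.PropositionalEquality as ≡ using (_≡_)

-- The formulas have one source. Write S(x) = xR(x) and L(x) = tS(x) + 1/x - 1/(2t). Completing the
-- square, the quadratic for R says that L(x)² - (1/x² - 1/(tx) - x) is free of x. Hence L(x)² -
-- L(y)² = (1/x - 1/y)P with P = 1/x + 1/y + xy - 1/t, where -txyP is the kernel xy - t(x + y +
-- x²y²). Since L(x) - L(y) = (1/x - 1/y)(1 - txyh), the other factor is L(x) + L(y) = P/(1 - txyh),
-- and this is the kernel equation for Q = h/(1 - txyh). Below, all denominators are cleared:
-- division by x - y becomes a cancellation law, and the inverse of 1 - txyh a fixed point. The
-- quadrant encodes the shrub condition. In an increasing forest the k-th smallest root, left child
-- and right child share a shrub, so children exceed their roots exactly when no initial segment of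
-- the labels holds more left children, or more right children, than roots.

-- Formal power series over a commutative ring.

module PowerSeries (A : CommutativeRing 0ℓ 0ℓ) where
  open CommutativeRing A
  open import Relation.Binary.Reasoning.Setoid setoid
  open import Algebra.Properties.CommutativeSemigroup +-commutativeSemigroup
    using (x∙yz≈y∙xz; interchange)

  Series : Set
  Series = ℕ → Carrier

  tail : Series → Series
  tail f n = f (suc n)

  infix 4 _≋_
  infixl 6 _⊕_
  infixl 7 _⊛_ _·_

  _≋_ : Series → Series → Set
  f ≋ g = ∀ n → f n ≈ g n

  _⊕_ : Series → Series → Series
  (f ⊕ g) n = f n + g n

  _·_ : Carrier → Series → Series
  (a · f) n = a * f n

  _⊛_ : Series → Series → Series
  (f ⊛ g) zero    = f 0 * g 0
  (f ⊛ g) (suc n) = f 0 * g (suc n) + (tail f ⊛ g) n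

  const : Carrier → Series
  const a zero    = a
  const a (suc _) = 0#

  var : Series
  var zero    = 0#
  var (suc n) = const 1# n

  Agree : ℕ → Series → Series → Set
  Agree n f g = ∀ {m} → m ≤ n → f m ≈ g m

  -- Only coefficients of degree at most n enter degree n of a product. This truncated congruence is
  -- what makes the iteration in `FixedPoint` converge.
  ⊛-agree : ∀ n {f f′ g g′} → Agree n f f′ → Agree n g g′ → (f ⊛ g) n ≈ (f′ ⊛ g′) n
  ⊛-agree zero    p q = *-cong (p z≤n) (q z≤n)
  ⊛-agree (suc n) p q =
    +-cong (*-cong (p z≤n) (q ℕₚ.≤-refl))
           (⊛-agree n (λ m≤n → p (s≤s m≤n)) (λ m≤n → q (ℕₚ.m≤n⇒m≤1+n m≤n)))

  ⊛-cong : ∀ {f f′ g g′} → f ≋ f′ → g ≋ g′ → f ⊛ g ≋ f′ ⊛ g′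
  ⊛-cong p q n = ⊛-agree n (λ {m} _ → p m) (λ {m} _ → q m)

  ⊛-zeroˡ : ∀ {f} → (∀ n → f n ≈ 0#) → ∀ g n → (f ⊛ g) n ≈ 0#
  ⊛-zeroˡ p g zero    = trans (*-congʳ (p 0)) (zeroˡ _)
  ⊛-zeroˡ p g (suc n) =
    trans (+-cong (trans (*-congʳ (p 0)) (zeroˡ _)) (⊛-zeroˡ (λ m → p (suc m)) g n)) (+-identityˡ 0#)

  const-⊛ : ∀ a f → const a ⊛ f ≋ a · f
  const-⊛ a f zero    = refl
  const-⊛ a f (suc n) = trans (+-congˡ (⊛-zeroˡ (λ _ → refl) f n)) (+-identityʳ _)


  var-⊛-suc : ∀ f n → (var ⊛ f) (suc n) ≈ f n
  var-⊛-suc f n = begin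
    0# * f (suc n) + (const 1# ⊛ f) n ≈⟨ +-cong (zeroˡ _) (const-⊛ 1# f n) ⟩
    0# + 1# * f n                     ≈⟨ +-identityˡ _ ⟩
    1# * f n                          ≈⟨ *-identityˡ _ ⟩
    f n                               ∎

  ⊛-distribʳ : ∀ h f g → (f ⊕ g) ⊛ h ≋ f ⊛ h ⊕ g ⊛ h
  ⊛-distribʳ h f g zero    = distribʳ _ _ _
  ⊛-distribʳ h f g (suc n) =
    trans (+-cong (distribʳ _ _ _) (⊛-distribʳ h (tail f) (tail g) n)) (interchange _ _ _ _)

  ·-⊛-assoc : ∀ a f g → (a · f) ⊛ g ≋ a · (f ⊛ g)
  ·-⊛-assoc a f g zero    = *-assoc _ _ _
  ·-⊛-assoc a f g (suc n) =
    trans (+-cong (*-assoc _ _ _) (·-⊛-assoc a (tail f) g n)) (sym (distribˡ _ _ _))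

  -- The product recurses on its left factor; peeling the right factor instead is what commutativity
  -- rests on.
  ⊛-sucʳ : ∀ f g n → (f ⊛ g) (suc n) ≈ f (suc n) * g 0 + (f ⊛ tail g) n
  ⊛-sucʳ f g zero    = +-comm _ _
  ⊛-sucʳ f g (suc n) = trans (+-congˡ (⊛-sucʳ (tail f) g n)) (x∙yz≈y∙xz _ _ _)

  ⊛-comm : ∀ f g → f ⊛ g ≋ g ⊛ f
  ⊛-comm f g zero    = *-comm _ _
  ⊛-comm f g (suc n) =
    trans (+-cong (*-comm _ _) (⊛-comm (tail f) g n)) (sym (⊛-sucʳ g f n))

  ⊛-assoc : ∀ f g h → (f ⊛ g) ⊛ h ≋ f ⊛ (g ⊛ h)
  ⊛-assoc f g h zero    = *-assoc _ _ _
  ⊛-assoc f g h (suc n) = begin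
    f 0 * g 0 * h (suc n) + ((f 0 · tail g ⊕ tail f ⊛ g) ⊛ h) n
      ≈⟨ +-cong (*-assoc _ _ _) (⊛-distribʳ h (f 0 · tail g) (tail f ⊛ g) n) ⟩
    f 0 * (g 0 * h (suc n)) + (((f 0 · tail g) ⊛ h) n + ((tail f ⊛ g) ⊛ h) n)
      ≈⟨ +-congˡ (+-cong (·-⊛-assoc (f 0) (tail g) h n) (⊛-assoc (tail f) g h n)) ⟩
    f 0 * (g 0 * h (suc n)) + (f 0 * (tail g ⊛ h) n + (tail f ⊛ (g ⊛ h)) n)
      ≈⟨ +-assoc _ _ _ ⟨
    f 0 * (g 0 * h (suc n)) + f 0 * (tail g ⊛ h) n + (tail f ⊛ (g ⊛ h)) n
      ≈⟨ +-congʳ (distribˡ _ _ _) ⟨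
    f 0 * (g 0 * h (suc n) + (tail g ⊛ h) n) + (tail f ⊛ (g ⊛ h)) n ∎

  ⊛-identityˡ : ∀ f → const 1# ⊛ f ≋ f
  ⊛-identityˡ f n = trans (const-⊛ 1# f n) (*-identityˡ _)

  commutativeRing : CommutativeRing 0ℓ 0ℓ
  commutativeRing = record
    { Carrier = Series
    ; _≈_ = _≋_
    ; _+_ = _⊕_
    ; _*_ = _⊛_
    ; -_ = λ f n → - f n
    ; 0# = λ _ → 0#
    ; 1# = const 1#
    ; isCommutativeRing = record
      { isRing = record
        { +-isAbelianGroup = record
          { isGroup = record
            { isMonoid = record
              { isSemigroup = record
                { isMagma = record
                  { isEquivalence = record
                    { refl = λ _ → refl
                    ; sym = λ p n → sym (p n)
                    ; trans = λ p q n → trans (p n) (q n)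
                    }
                  ; ∙-cong = λ p q n → +-cong (p n) (q n)
                  }
                ; assoc = λ f g h n → +-assoc _ _ _
                }
              ; identity = (λ f n → +-identityˡ _) , (λ f n → +-identityʳ _)
              }
            ; inverse = (λ f n → -‿inverseˡ _) , (λ f n → -‿inverseʳ _)
            ; ⁻¹-cong = λ p n → -‿cong (p n)
            }
          ; comm = λ f g n → +-comm _ _
          }
        ; *-cong = ⊛-cong
        ; *-assoc = ⊛-assoc
        ; *-identity = ⊛-identityˡ , (λ f n → trans (⊛-comm f _ n) (⊛-identityˡ f n))
        ; distrib = (λ f g h n → trans (⊛-comm f _ n)
                      (trans (⊛-distribʳ f g h n) (+-cong (⊛-comm g f n) (⊛-comm h f n))))
                  , ⊛-distribʳ
        }
      ; *-comm = ⊛-comm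
      }
    }

  const-cong : ∀ {a b} → a ≈ b → const a ≋ const b
  const-cong p zero    = p
  const-cong p (suc _) = refl

  const-+ : ∀ a b → const (a + b) ≋ const a ⊕ const b
  const-+ a b zero    = refl
  const-+ a b (suc _) = sym (+-identityˡ 0#)

  const-* : ∀ a b → const (a * b) ≋ const a ⊛ const b
  const-* a b zero    = refl
  const-* a b (suc n) = sym (trans (const-⊛ a (const b) (suc n)) (zeroʳ _))

  open import Algebra.Definitions.RawSemiring (Semiring.rawSemiring (CommutativeRing.semiring commutativeRing)) public
    using (_^_)

  ^-agree : ∀ k n {f g} → Agree n f g → Agree n (f ^ k) (g ^ k)
  ^-agree zero    n p m≤n = refl
  ^-agree (suc k) n p {m} m≤n =
    ⊛-agree m (λ l≤m → p (ℕₚ.≤-trans l≤m m≤n)) (λ l≤m → ^-agree k n p (ℕₚ.≤-trans l≤m m≤n))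

  -- Solves F = 1 + zvFᵖ for the series variable z. The factor z delays every dependence by one
  -- degree, so the n-th iterate is already right up to degree n and `fix` may read its coefficients
  -- off the diagonal. The cases p = 3, 2, 1 give `T`, `c` and the geometric series `E` = 1/(1 -
  -- txyh).
  module FixedPoint (p : ℕ) (v : Series) where

    approx : ℕ → Series
    approx zero    = const 1#
    approx (suc n) = const 1# ⊕ var ⊛ (v ⊛ approx n ^ p)

    step-agree : ∀ n {f g} → Agree n f g →
      Agree (suc n) (const 1# ⊕ var ⊛ (v ⊛ f ^ p)) (const 1# ⊕ var ⊛ (v ⊛ g ^ p))
    step-agree n e {zero}  _         = +-congˡ (trans (zeroˡ _) (sym (zeroˡ _)))
    step-agree n e {suc m} (s≤s m≤n) = +-congˡ (trans (var-⊛-suc _ m) (trans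
      (⊛-agree m (λ _ → refl) (λ l≤m → ^-agree p n e (ℕₚ.≤-trans l≤m m≤n)))
      (sym (var-⊛-suc _ m))))

    approx-agree : ∀ {m n} → m ≤ n → Agree m (approx m) (approx n)
    approx-agree {zero} {zero}  z≤n z≤n = refl
    approx-agree {zero} {suc n} z≤n z≤n = sym (trans (+-congˡ (zeroˡ _)) (+-identityʳ _))
    approx-agree (s≤s m≤n) = step-agree _ (approx-agree m≤n)

    fix : Series
    fix n = approx n n

    fix-eq : fix ≋ const 1# ⊕ var ⊛ (v ⊛ fix ^ p)
    fix-eq zero    = sym (trans (+-congˡ (zeroˡ _)) (+-identityʳ _))
    fix-eq (suc n) = step-agree n (λ m≤n → sym (approx-agree m≤n ℕₚ.≤-refl)) ℕₚ.≤-refl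

-- Subtraction-free polynomial identities behind the kernel equation.

module Identities (A : CommutativeRing 0ℓ 0ℓ) where
  open CommutativeRing A
  open import Relation.Binary.Reasoning.Setoid setoid
  open import Algebra.Solver.Ring.NaturalCoefficients.Default commutativeSemiring
  open import Algebra.Properties.Group +-group using (//-rightDividesˡ)
  open import Algebra.Properties.Ring ring using (+-cancelʳ)

  two : Carrier
  two = 1# + 1#

  subtract-add : ∀ a b → a - b + b ≈ a
  subtract-add a b = //-rightDividesˡ b a

  ternary : ∀ {t T} → T ≈ 1# + t * (two * two * (t * t) * (T * (T * (T * 1#)))) →
    T ≈ 1# + two * (two * (t * (t * (t * (T * (T * T))))))
  ternary {t} {T} eq = trans eq (+-congˡ
    (solve 2 (λ t T → t :* (con 2 :* con 2 :* (t :* t) :* (T :* (T :* (T :* con 1))))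
                   := con 2 :* (con 2 :* (t :* (t :* (t :* (T :* (T :* T))))))) refl t T))

  -- For F = Tᵏ this reads Tᵏ⁺¹ = Tᵏ + 4t³Tᵏ⁺³, the recurrence of `fussCatalan`. The factors are
  -- nested so that each `two` and each `t` can be stripped from a coefficient one at a time.
  ternary-power : ∀ {t T F} → T ≈ 1# + two * (two * (t * (t * (t * (T * (T * T)))))) →
    T * F ≈ F + two * (two * (t * (t * (t * (T * (T * (T * F)))))))
  ternary-power {t} {T} {F} eq = trans (*-congʳ eq)
    (solve 3 (λ t T F → (con 1 :+ con 2 :* (con 2 :* (t :* (t :* (t :* (T :* (T :* T))))))) :* F
                     := F :+ con 2 :* (con 2 :* (t :* (t :* (t :* (T :* (T :* (T :* F)))))))) refl t T F)

  -- Since `c` and `E` have constant coefficient 1, the first summand is what `Q 0 0` computes to;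
  -- the claim is T(1 - q) + qT = T, with qT = 2t³T⁴.
  constant-term : ∀ t T → let q = two * (t * (t * (t * (T * (T * T))))) in
    T * (1# * (1# - q * 1#)) * 1# + two * (t * (t * (t * (T * (T * (T * (T * 1#))))))) ≈ T * 1#
  constant-term t T = begin
    T * (1# * (1# - q * 1#)) * 1# + two * (t * (t * (t * (T * (T * (T * (T * 1#)))))))
      ≈⟨ solve 3 (λ t T d → T :* (con 1 :* d) :* con 1 :+ con 2 :* (t :* (t :* (t :* (T :* (T :* (T :* (T :* con 1)))))))
           := T :* (d :+ con 2 :* (t :* (t :* (t :* (T :* (T :* T))))) :* con 1)) refl t T (1# - q * 1#) ⟩
    T * (1# - q * 1# + q * 1#)
      ≈⟨ *-congˡ (subtract-add 1# (q * 1#)) ⟩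
    T * 1# ∎
    where q = two * (t * (t * (t * (T * (T * T)))))

  -- The equation for R = Tcs multiplied by x, with R(0) = Ts₀; here s and s₀ stand for 1 - qc and 1 - q.
  catalytic : ∀ {x t T c q s s₀} →
    T ≈ 1# + two * q → q ≈ two * (t * (t * (t * (T * (T * T))))) →
    c ≈ 1# + x * (t * t * (T * T) * (c * (c * 1#))) →
    s + q * c ≈ 1# → s₀ + q ≈ 1# →
    x * (T * (c * s)) + two * t * (T * s₀) ≈
    x + two * t * (T * (c * s)) + t * t * (x * x * (T * (c * s) * (T * (c * s))))
  catalytic {x} {t} {T} {c} {q} {s} {s₀} T-eq q-eq c-fix s-eq s₀-eq = begin
    x * (T * (c * s)) + two * t * (T * s₀)
      ≈⟨ +-congˡ (*-congˡ (*-congˡ s₀≈s+qu)) ⟩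
    x * (T * (c * s)) + two * t * (T * (s + q * u))
      -- The product 2tT · qu contains 2t³T³, so it equals x · c²q · q. Trading 2t³T³ for `q` here,
      -- and back again further down, reduces the claim to `reduced` and `c-eq`.
      ≈⟨ solve 6 (λ x t T c s q →
           x :* (T :* (c :* s)) :+ (con 2 :* t) :* (T :* (s :+ q :* (x :* (t :* t :* (T :* T) :* (c :* c)))))
        := x :* (T :* (c :* s) :+ c :* c :* q :* (con 2 :* (t :* (t :* (t :* (T :* (T :* T))))))) :+ con 2 :* t :* T :* s)
           refl x t T c s q ⟩
    x * (T * (c * s) + c * c * q * (two * (t * (t * (t * (T * (T * T))))))) + two * t * T * s
      ≈⟨ +-congʳ (*-congˡ (+-congˡ (*-congˡ q-eq))) ⟨
    x * (T * (c * s) + c * c * q * q) + two * t * T * s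
      ≈⟨ +-congʳ (*-congˡ reduced) ⟩
    x * (1# + c * c * s * q + u * s * s) + two * t * T * s
      ≈⟨ +-congʳ (*-congˡ (+-congʳ (+-congˡ (*-congˡ q-eq)))) ⟩
    x * (1# + c * c * s * (two * (t * (t * (t * (T * (T * T)))))) + u * s * s) + two * t * T * s
      ≈⟨ solve 5 (λ x t T c s →
           x :* (con 1 :+ c :* c :* s :* (con 2 :* (t :* (t :* (t :* (T :* (T :* T))))))
                 :+ x :* (t :* t :* (T :* T) :* (c :* c)) :* s :* s) :+ con 2 :* t :* T :* s
        := x :+ con 2 :* t :* (T :* ((con 1 :+ x :* (t :* t :* (T :* T) :* (c :* c))) :* s))
             :+ t :* t :* (x :* x :* (T :* (c :* s) :* (T :* (c :* s))))) refl x t T c s ⟩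
    x + two * t * (T * ((1# + u) * s)) + t * t * (x * x * (T * (c * s) * (T * (c * s))))
      ≈⟨ +-congʳ (+-congˡ (*-congˡ (*-congˡ (*-congʳ c-eq)))) ⟨
    x + two * t * (T * (c * s)) + t * t * (x * x * (T * (c * s) * (T * (c * s)))) ∎
    where
    u = x * (t * t * (T * T) * (c * c))
    c-eq : c ≈ 1# + u
    c-eq = trans c-fix (+-congˡ (*-congˡ (*-congˡ (*-congˡ (*-identityʳ c)))))
    s₀≈s+qu : s₀ ≈ s + q * u
    s₀≈s+qu = +-cancelʳ q s₀ (s + q * u) (begin
      s₀ + q             ≈⟨ s₀-eq ⟩
      1#                 ≈⟨ s-eq ⟨
      s + q * c          ≈⟨ +-congˡ (*-congˡ c-eq) ⟩
      s + q * (1# + u)   ≈⟨ solve 3 (λ s q u → s :+ q :* (con 1 :+ u) := s :+ q :* u :+ q) refl s q u ⟩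
      s + q * u + q      ∎)
    -- Writing T = 1 + 2q as s + qc + 2q and one factor c as 1 + u makes the square (s + qc)² = 1
    -- appear.
    reduced : T * (c * s) + c * c * q * q ≈ 1# + c * c * s * q + u * s * s
    reduced = begin
      T * (c * s) + c * c * q * q
        ≈⟨ +-congʳ (*-congʳ (trans T-eq (+-congʳ (sym s-eq)))) ⟩
      (s + q * c + two * q) * (c * s) + c * c * q * q
        ≈⟨ solve 3 (λ c s q → (s :+ q :* c :+ con 2 :* q) :* (c :* s) :+ c :* c :* q :* q
             := c :* (s :* s) :+ (c :* c :* s :* q :+ con 2 :* q :* c :* s :+ c :* c :* q :* q)) refl c s q ⟩
      c * (s * s) + (c * c * s * q + two * q * c * s + c * c * q * q)
        ≈⟨ +-congʳ (*-congʳ c-eq) ⟩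
      (1# + u) * (s * s) + (c * c * s * q + two * q * c * s + c * c * q * q)
        ≈⟨ solve 4 (λ c s q u →
             (con 1 :+ u) :* (s :* s) :+ (c :* c :* s :* q :+ con 2 :* q :* c :* s :+ c :* c :* q :* q)
             := (s :+ q :* c) :* (s :+ q :* c) :+ c :* c :* s :* q :+ u :* s :* s) refl c s q u ⟩
      (s + q * c) * (s + q * c) + c * c * s * q + u * s * s
        ≈⟨ +-congʳ (+-congʳ (trans (*-cong s-eq s-eq) (*-identityˡ 1#))) ⟩
      1# + c * c * s * q + u * s * s ∎

  -- Substituting y for x coefficientwise produces `const ∘ var` and `const ∘ const t`, which match
  -- `y` and `tᶜ` only up to `≈`.
  catalytic-cong : ∀ {x x′ t t′ r k k′} → x ≈ x′ → t ≈ t′ → k ≈ k′ →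
    x * r + k ≈ x + two * t * r + t * t * (x * x * (r * r)) →
    x′ * r + k′ ≈ x′ + two * t′ * r + t′ * t′ * (x′ * x′ * (r * r))
  catalytic-cong x-eq t-eq k-eq eq =
    trans (sym (+-cong (*-congʳ x-eq) k-eq)) (trans eq
      (+-cong (+-cong x-eq (*-congʳ (*-congˡ t-eq))) (*-cong (*-cong t-eq t-eq) (*-congʳ (*-cong x-eq x-eq)))))

  -- This is (x - y) · lhs ≈ (x - y) · rhs without subtraction; dividing lhs ≈ rhs by 1 - txyh gives the kernel equation.
  divided-difference : ∀ {x y t r r′ h k} →
    x * r + k ≈ x + two * t * r + t * t * (x * x * (r * r)) →
    y * r′ + k ≈ y + two * t * r′ + t * t * (y * y * (r′ * r′)) →
    x * h + y * r′ ≈ y * h + x * r →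
    let lhs = x * y * h + t * (x * r + y * r′)
        rhs = x * y + t * ((x + y) * h) + t * t * (x * y * h * (x * r + y * r′))
    in x * lhs + y * rhs ≈ x * rhs + y * lhs
  divided-difference {x} {y} {t} {r} {r′} {h} {k} r-eq r′-eq h-eq =
    +-cancelʳ (combination (y * h + x * r) (x * h + y * r′) R₁ L₂) _ _ (begin
      x * lhs + y * rhs + combination (y * h + x * r) (x * h + y * r′) R₁ L₂
        ≈⟨ solve 7 (λ x y t r r′ h k →
             let lhs = x :* y :* h :+ t :* (x :* r :+ y :* r′)
                 rhs = x :* y :+ t :* ((x :+ y) :* h) :+ t :* t :* (x :* y :* h :* (x :* r :+ y :* r′))
                 comb = λ α β γ δ → x :* y :* α :+ (t :* (x :+ y) :+ t :* t :* (x :* y :* (x :* r :+ y :* r′))) :* β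
                                    :+ x :* y :* γ :+ x :* y :* δ
                 HL = x :* h :+ y :* r′
                 HR = y :* h :+ x :* r
                 L₁ = x :* r :+ k
                 R₁ = x :+ con 2 :* t :* r :+ t :* t :* (x :* x :* (r :* r))
                 L₂ = y :* r′ :+ k
                 R₂ = y :+ con 2 :* t :* r′ :+ t :* t :* (y :* y :* (r′ :* r′))
             in x :* lhs :+ y :* rhs :+ comb HR HL R₁ L₂ := x :* rhs :+ y :* lhs :+ comb HL HR L₁ R₂)
             refl x y t r r′ h k ⟩
      x * rhs + y * lhs + combination (x * h + y * r′) (y * h + x * r) L₁ R₂
        ≈⟨ +-congˡ (+-cong (+-cong (+-cong (*-congˡ h-eq) (*-congˡ (sym h-eq))) (*-congˡ r-eq)) (*-congˡ (sym r′-eq))) ⟩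
      x * rhs + y * lhs + combination (y * h + x * r) (x * h + y * r′) R₁ L₂ ∎)
    where
    lhs = x * y * h + t * (x * r + y * r′)
    rhs = x * y + t * ((x + y) * h) + t * t * (x * y * h * (x * r + y * r′))
    L₁ = x * r + k
    R₁ = x + two * t * r + t * t * (x * x * (r * r))
    L₂ = y * r′ + k
    R₂ = y + two * t * r′ + t * t * (y * y * (r′ * r′))
    -- The multipliers of the hypotheses. Those of `h-eq` replace (x - y)h by xr - yr′ in `lhs` and
    -- `rhs`, which turns the last product into a difference of squares; what remains is xy times
    -- the difference of `r-eq` and `r′-eq`, where `k` drops out. Negative multiples are realised by
    -- swapping the two sides of a hypothesis.
    combination : Carrier → Carrier → Carrier → Carrier → Carrier
    combination α β γ δ =
      x * y * α + (t * (x + y) + t * t * (x * y * (x * r + y * r′))) * β + x * y * γ + x * y * δ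

  -- Multiplying by E divides by 1 - txyh: expanding E once in twE produces t²xyhwE, which cancels
  -- the last term on the right, and expanding it in xyE produces the diagonal step t · x²y² · hE.
  kernel : ∀ {x y t w h E} →
    x * y * h + t * w ≈ x * y + t * ((x + y) * h) + t * t * (x * y * h * w) →
    E ≈ 1# + y * (t * (x * h) * (E * 1#)) →
    y * (x * (h * E)) + t * w ≈ y * (x * 1#) + t * (x * (h * E) + y * (h * E) + y * (x * (y * (x * (h * E)))))
  kernel {x} {y} {t} {w} {h} {E} eq E-eq = +-cancelʳ (t * t * (x * y * h * w * E)) _ _ (begin
    y * (x * (h * E)) + t * w + t * t * (x * y * h * w * E)
      ≈⟨ solve 6 (λ x y t w h E →
           y :* (x :* (h :* E)) :+ t :* w :+ t :* t :* (x :* y :* h :* w :* E)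
        := x :* y :* (h :* E) :+ t :* w :* (con 1 :+ y :* (t :* (x :* h) :* (E :* con 1)))) refl x y t w h E ⟩
    x * y * (h * E) + t * w * (1# + y * (t * (x * h) * (E * 1#)))
      ≈⟨ +-congˡ (*-congˡ E-eq) ⟨
    x * y * (h * E) + t * w * E
      ≈⟨ solve 6 (λ x y t w h E →
           x :* y :* (h :* E) :+ t :* w :* E := (x :* y :* h :+ t :* w) :* E) refl x y t w h E ⟩
    (x * y * h + t * w) * E
      ≈⟨ *-congʳ eq ⟩
    (x * y + t * ((x + y) * h) + t * t * (x * y * h * w)) * E
      ≈⟨ solve 6 (λ x y t w h E →
           (x :* y :+ t :* ((x :+ y) :* h) :+ t :* t :* (x :* y :* h :* w)) :* E
        := x :* y :* E :+ t :* ((x :+ y) :* (h :* E)) :+ t :* t :* (x :* y :* h :* w :* E)) refl x y t w h E ⟩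
    x * y * E + t * ((x + y) * (h * E)) + t * t * (x * y * h * w * E)
      ≈⟨ +-congʳ (+-congʳ (*-congˡ E-eq)) ⟩
    x * y * (1# + y * (t * (x * h) * (E * 1#))) + t * ((x + y) * (h * E)) + t * t * (x * y * h * w * E)
      ≈⟨ solve 6 (λ x y t w h E →
           x :* y :* (con 1 :+ y :* (t :* (x :* h) :* (E :* con 1))) :+ t :* ((x :+ y) :* (h :* E)) :+ t :* t :* (x :* y :* h :* w :* E)
        := y :* (x :* con 1) :+ t :* (x :* (h :* E) :+ y :* (h :* E) :+ y :* (x :* (y :* (x :* (h :* E))))) :+ t :* t :* (x :* y :* h :* w :* E))
           refl x y t w h E ⟩
    y * (x * 1#) + t * (x * (h * E) + y * (h * E) + y * (x * (y * (x * (h * E))))) + t * t * (x * y * h * w * E) ∎)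

  double : ∀ a → two * a ≈ a + a
  double a = solve 1 (λ a → con 2 :* a := a :+ a) refl a

-- Homomorphisms between series rings.

module Ring (A : CommutativeRing 0ℓ 0ℓ) where
  open CommutativeRing A public
  open Identities A public

IsHom : (A B : CommutativeRing 0ℓ 0ℓ) → (CommutativeRing.Carrier A → CommutativeRing.Carrier B) → Set
IsHom A B = IsSemiringHomomorphism (Semiring.rawSemiring (CommutativeRing.semiring A)) (Semiring.rawSemiring (CommutativeRing.semiring B))

series : CommutativeRing 0ℓ 0ℓ → CommutativeRing 0ℓ 0ℓ
series = PowerSeries.commutativeRing

const-isHom : ∀ A → IsHom A (series A) (PowerSeries.const A)
const-isHom A = record
  { isNearSemiringHomomorphism = record
    { +-isMonoidHomomorphism = record
      { isMagmaHomomorphism = record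
        { isRelHomomorphism = record { cong = const-cong }
        ; homo = const-+
        }
      ; ε-homo = λ { zero → refl ; (suc _) → refl }
      }
    ; *-homo = const-*
    }
  ; 1#-homo = λ _ → refl
  }
  where
  open CommutativeRing A
  open PowerSeries A

-- With `const` for φ this is the substitution of y for x: a series in x becomes a series in y with
-- coefficients constant in x. It carries the equation of R(x) to R(y).
map-isHom : ∀ A B {φ} → IsHom A B φ → IsHom (series A) (series B) (φ ∘_)
map-isHom A B {φ} φ-hom = record
  { isNearSemiringHomomorphism = record
    { +-isMonoidHomomorphism = record
      { isMagmaHomomorphism = record
        { isRelHomomorphism = record { cong = λ p n → ⟦⟧-cong (p n) }
        ; homo = λ f g n → +-homo (f n) (g n)
        }
      ; ε-homo = λ _ → 0#-homo
      }
    ; *-homo = map-⊛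
    }
  ; 1#-homo = λ { zero → 1#-homo ; (suc _) → 0#-homo }
  }
  where
  open IsSemiringHomomorphism φ-hom
  open CommutativeRing B
  module A = PowerSeries A
  module B = PowerSeries B
  map-⊛ : ∀ f g n → φ ((f A.⊛ g) n) ≈ ((φ ∘ f) B.⊛ (φ ∘ g)) n
  map-⊛ f g zero    = *-homo _ _
  map-⊛ f g (suc n) = trans (+-homo _ _) (+-cong (*-homo _ _) (map-⊛ (A.tail f) g n))

module Transport (A B : CommutativeRing 0ℓ 0ℓ) {φ} (φ-hom : IsHom A B φ) where
  private
    module A = Ring A
  open Ring B
  open IsSemiringHomomorphism φ-hom

  infixl 6 _⟨+⟩_
  infixl 7 _⟨*⟩_

  _⟨+⟩_ : ∀ {a b a′ b′} → φ a ≈ a′ → φ b ≈ b′ → φ (a A.+ b) ≈ a′ + b′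
  p ⟨+⟩ q = trans (+-homo _ _) (+-cong p q)

  _⟨*⟩_ : ∀ {a b a′ b′} → φ a ≈ a′ → φ b ≈ b′ → φ (a A.* b) ≈ a′ * b′
  p ⟨*⟩ q = trans (*-homo _ _) (*-cong p q)

  two-homo : φ A.two ≈ two
  two-homo = 1#-homo ⟨+⟩ 1#-homo

  catalytic-homo : ∀ {x t r k} →
    x A.* r A.+ k A.≈ x A.+ A.two A.* t A.* r A.+ t A.* t A.* (x A.* x A.* (r A.* r)) →
    φ x * φ r + φ k ≈ φ x + two * φ t * φ r + φ t * φ t * (φ x * φ x * (φ r * φ r))
  catalytic-homo eq = trans (sym ((refl ⟨*⟩ refl) ⟨+⟩ refl)) (trans (⟦⟧-cong eq)
    (refl ⟨+⟩ two-homo ⟨*⟩ refl ⟨*⟩ refl ⟨+⟩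
      refl ⟨*⟩ refl ⟨*⟩ (refl ⟨*⟩ refl ⟨*⟩ (refl ⟨*⟩ refl))))

-- Series in two variables, and division by x - y.

-- F j i is the coefficient of xⁱyʲ.
module Bivariate (A : CommutativeRing 0ℓ 0ℓ) where
  private
    module A = CommutativeRing A
    module X = PowerSeries A
    B = series A
    module B = CommutativeRing B
    module Y = PowerSeries B
  C = series B
  open CommutativeRing C
  open import Algebra.Properties.Ring A.ring using (+-cancelʳ)

  x y : Carrier
  x = Y.const X.var
  y = Y.var

  coeff-x-zero : ∀ F j → (x * F) j 0 A.≈ A.0#
  coeff-x-zero F j = A.trans (Y.const-⊛ X.var F j 0) (A.zeroˡ _)

  coeff-x : ∀ F j i → (x * F) j (suc i) A.≈ F j i
  coeff-x F j i = A.trans (Y.const-⊛ X.var F j (suc i)) (X.var-⊛-suc (F j) i)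

  coeff-y-zero : ∀ F i → (y * F) 0 i A.≈ A.0#
  coeff-y-zero F i = B.zeroˡ (F 0) i

  coeff-y : ∀ F j i → (y * F) (suc j) i A.≈ F j i
  coeff-y F j i = Y.var-⊛-suc F j i

  coeff-const : ∀ a F j i → (Y.const (X.const a) * F) j i A.≈ a A.* F j i
  coeff-const a F j i = A.trans (Y.const-⊛ (X.const a) F j i) (X.const-⊛ a (F j) i)

  -- Coefficients of xⁱ⁺¹yʲ relate (j , i) to (j - 1 , i + 1), so equality spreads along each
  -- antidiagonal from j = 0, where the multiples of y vanish.
  x-y-cancel : ∀ {F G} → x * F + y * G ≈ x * G + y * F → F ≈ G
  x-y-cancel {F} {G} eq zero i =
    +-cancelʳ A.0# _ _ (A.trans (A.sym (A.+-cong (coeff-x F 0 i) (coeff-y-zero G (suc i))))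
      (A.trans (eq 0 (suc i)) (A.+-cong (coeff-x G 0 i) (coeff-y-zero F (suc i)))))
  x-y-cancel {F} {G} eq (suc j) i =
    +-cancelʳ (G j (suc i)) _ _ (A.trans (A.sym (A.+-cong (coeff-x F (suc j) i) (coeff-y G j (suc i))))
      (A.trans (eq (suc j) (suc i)) (A.+-cong (coeff-x G (suc j) i)
        (A.trans (coeff-y F j (suc i)) (x-y-cancel eq j (suc i))))))

  -- This is (xr(x) - yr(y))/(x - y): a term xᵏ⁺¹ of xr(x) contributes every xⁱyʲ with i + j = k.
  diff-quotient : X.Series → Carrier
  diff-quotient r j i = r (j ℕ.+ i)

  diff-quotient-eq : ∀ r →
    x * diff-quotient r + y * (X.const ∘ r) ≈ y * diff-quotient r + x * Y.const r
  diff-quotient-eq r = λ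
    { zero zero → A.trans (A.+-cong (coeff-x-zero h 0) (coeff-y-zero r′ 0))
        (A.sym (A.+-cong (coeff-y-zero h 0) (coeff-x-zero (Y.const r) 0)))
    ; zero (suc i) → A.trans (A.+-cong (coeff-x h 0 i) (coeff-y-zero r′ (suc i)))
        (A.trans (A.+-comm _ _)
          (A.sym (A.+-cong (coeff-y-zero h (suc i)) (coeff-x (Y.const r) 0 i))))
    ; (suc j) zero → A.trans (A.+-cong (coeff-x-zero h (suc j)) (coeff-y r′ j 0))
        (A.trans (A.+-comm _ _)
          (A.sym (A.+-cong (A.trans (coeff-y h j 0) (A.reflexive (≡.cong r (ℕₚ.+-identityʳ j))))
                           (coeff-x-zero (Y.const r) (suc j)))))
    ; (suc j) (suc i) → A.trans (A.+-cong (coeff-x h (suc j) i) (coeff-y r′ j (suc i)))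
        (A.sym (A.+-cong (A.trans (coeff-y h j (suc i)) (A.reflexive (≡.cong r (ℕₚ.+-suc j i))))
                         (coeff-x (Y.const r) (suc j) i)))
    }
    where
    h = diff-quotient r
    r′ = X.const ∘ r

-- Kreweras walks and their generating function.

open import Data.Nat.Base using (_+_; _*_; _^_; _<_; _>_; _!)
open import Data.Nat.Solver using (module +-*-Solver)
open import Data.Integer.Base as ℤ using (+_)
import Data.Integer.Properties as ℤₚ
open import Relation.Binary.PropositionalEquality using (refl; sym; trans; cong; cong₂; subst)

-- walks m i j counts the quadrant walks of length m from the origin to (i , j).
walks : ℕ → ℕ → ℕ → ℕ
diagonal : ℕ → ℕ → ℕ → ℕ

walks zero    zero zero = 1
walks zero    _    _    = 0
walks (suc m) i    j    = walks m i (suc j) + walks m (suc i) j + diagonal m i j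

diagonal m (suc i) (suc j) = walks m i j
diagonal m _       _       = 0

-- The coefficient of t³ⁿ in Tᵏ, so the usual Fuss–Catalan number is scaled by 4ⁿ.
fussCatalan : ℕ → ℕ → ℕ
fussCatalan k       zero    = 1
fussCatalan zero    (suc n) = 0
fussCatalan (suc k) (suc n) = fussCatalan k (suc n) + 4 * fussCatalan (3 + k) n

-- 𝕋, 𝕏 and 𝕐 are ℤ[[t]], ℤ[[t]][[x]] and ℤ[[t]][[x]][[y]]; A, B and C are their ring structures.
module Kreweras where
  module 𝕋 = PowerSeries ℤₚ.+-*-commutativeRing
  module A = Ring 𝕋.commutativeRing
  module 𝕏 = PowerSeries 𝕋.commutativeRing
  module B = Ring 𝕏.commutativeRing
  module 𝕐 = PowerSeries 𝕏.commutativeRing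
  module C = Ring 𝕐.commutativeRing
  open Bivariate 𝕋.commutativeRing

  t T q s₀ : A.Carrier
  t = 𝕋.var
  T = 𝕋.FixedPoint.fix 3 (A.two A.* A.two A.* (t A.* t))
  q = A.two A.* (t A.* (t A.* (t A.* (T A.* (T A.* T)))))
  s₀ = A.1# A.- q

  T-eq : T A.≈ A.1# A.+ A.two A.* q
  T-eq = A.ternary (𝕋.FixedPoint.fix-eq 3 (A.two A.* A.two A.* (t A.* t)))

  v c s R : B.Carrier
  v = 𝕏.const t B.* 𝕏.const t B.* (𝕏.const T B.* 𝕏.const T)
  c = 𝕏.FixedPoint.fix 2 v
  s = B.1# B.- 𝕏.const q B.* c
  R = 𝕏.const T B.* (c B.* s)

  R-catalytic : 𝕏.var B.* R B.+ 𝕏.const (A.two A.* t A.* (T A.* s₀)) B.≈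
    𝕏.var B.+ B.two B.* 𝕏.const t B.* R B.+ 𝕏.const t B.* 𝕏.const t B.* (𝕏.var B.* 𝕏.var B.* (R B.* R))
  R-catalytic = B.trans
    (B.+-congˡ {x = 𝕏.var B.* R} (two-homo ⟨*⟩ B.refl ⟨*⟩ (B.refl ⟨*⟩ B.refl)))
    (B.catalytic {T = 𝕏.const T} {c} {𝕏.const q} {s} {𝕏.const s₀}
      (B.trans (⟦⟧-cong T-eq) (1#-homo ⟨+⟩ two-homo ⟨*⟩ B.refl))
      (two-homo ⟨*⟩ (B.refl ⟨*⟩ (B.refl ⟨*⟩ (B.refl ⟨*⟩ (B.refl ⟨*⟩ (B.refl ⟨*⟩ B.refl))))))
      (𝕏.FixedPoint.fix-eq 2 v)
      (B.subtract-add B.1# (𝕏.const q B.* c))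
      (B.trans (B.sym (+-homo s₀ q)) (B.trans (⟦⟧-cong (A.subtract-add A.1# q)) 1#-homo)))
    where
    const-hom = const-isHom 𝕋.commutativeRing
    open Transport 𝕋.commutativeRing 𝕏.commutativeRing const-hom
    open IsSemiringHomomorphism const-hom

  tᶜ r r′ h E Q : C.Carrier
  tᶜ = 𝕐.const (𝕏.const t)
  r = 𝕐.const R
  r′ = 𝕏.const ∘ R
  h = diff-quotient R
  E = 𝕐.FixedPoint.fix 1 (tᶜ C.* (x C.* h))
  Q = h C.* E

  r-catalytic : x C.* r C.+ 𝕐.const (𝕏.const (A.two A.* t A.* (T A.* s₀))) C.≈
    x C.+ C.two C.* tᶜ C.* r C.+ tᶜ C.* tᶜ C.* (x C.* x C.* (r C.* r))
  r-catalytic = Transport.catalytic-homo 𝕏.commutativeRing 𝕐.commutativeRing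
    (const-isHom 𝕏.commutativeRing) {x = 𝕏.var} {t = 𝕏.const t} R-catalytic

  const∘const : ∀ a → 𝕏.const ∘ 𝕏.const a C.≈ 𝕐.const (𝕏.const a)
  const∘const a = λ { zero → B.refl ; (suc _) → λ { zero → A.refl ; (suc _) → A.refl } }

  const∘var : 𝕏.const ∘ 𝕏.var C.≈ y
  const∘var = λ { zero → 0#-homo ; (suc n) → const∘const A.1# n }
    where open IsSemiringHomomorphism (const-isHom 𝕋.commutativeRing)

  r′-catalytic : y C.* r′ C.+ 𝕐.const (𝕏.const (A.two A.* t A.* (T A.* s₀))) C.≈
    y C.+ C.two C.* tᶜ C.* r′ C.+ tᶜ C.* tᶜ C.* (y C.* y C.* (r′ C.* r′))
  r′-catalytic = C.catalytic-cong {r = r′} const∘var (const∘const t) (const∘const _)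
    (Transport.catalytic-homo 𝕏.commutativeRing 𝕐.commutativeRing
      (map-isHom 𝕋.commutativeRing 𝕏.commutativeRing (const-isHom 𝕋.commutativeRing))
      {x = 𝕏.var} {t = 𝕏.const t} R-catalytic)

  kernel-equation :
    y C.* (x C.* Q) C.+ tᶜ C.* (x C.* r C.+ y C.* r′) C.≈
    y C.* (x C.* C.1#) C.+ tᶜ C.* (x C.* Q C.+ y C.* Q C.+ y C.* (x C.* (y C.* (x C.* Q))))
  kernel-equation = C.kernel {x = x} {y} {tᶜ} {h = h} {E}
    (x-y-cancel (C.divided-difference {x = x} {y} {tᶜ} {r} {r′} {h} r-catalytic r′-catalytic (diff-quotient-eq R)))
    (𝕐.FixedPoint.fix-eq 1 (tᶜ C.* (x C.* h)))

  -- Read at xⁱ⁺¹yʲ⁺¹, the kernel equation loses its boundary series: xR(x) has no positive power of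
  -- y, and yR(y) none of x. What is left splits a walk by its last step.
  Q-recurrence : ∀ j i → Q j i A.≈ C.1# j i A.+ t A.* (Q (suc j) i A.+ Q j (suc i) A.+ (y C.* (x C.* Q)) j i)
  Q-recurrence j i = begin
    Q j i ≈⟨ A.+-identityʳ _ ⟨
    Q j i A.+ A.0# ≈⟨ A.+-cong (coeff-yx Q) (A.trans (coeff-const t _ (suc j) (suc i))
       (A.trans (A.*-congˡ (A.trans (A.+-cong (coeff-x r (suc j) i) (coeff-y r′ j (suc i))) (A.+-identityʳ A.0#))) (A.zeroʳ t))) ⟨
    (y C.* (x C.* Q) C.+ tᶜ C.* (x C.* r C.+ y C.* r′)) (suc j) (suc i)
      ≈⟨ kernel-equation (suc j) (suc i) ⟩
    (y C.* (x C.* C.1#) C.+ tᶜ C.* (x C.* Q C.+ y C.* Q C.+ y C.* (x C.* (y C.* (x C.* Q))))) (suc j) (suc i)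
      ≈⟨ A.+-cong (coeff-yx C.1#) (A.trans (coeff-const t _ (suc j) (suc i)) (A.*-congˡ
           (A.+-cong (A.+-cong (coeff-x Q (suc j) i) (coeff-y Q j (suc i))) (coeff-yx (y C.* (x C.* Q)))))) ⟩
    C.1# j i A.+ t A.* (Q (suc j) i A.+ Q j (suc i) A.+ (y C.* (x C.* Q)) j i) ∎
    where
    open import Relation.Binary.Reasoning.Setoid A.setoid
    coeff-yx : ∀ F → (y C.* (x C.* F)) (suc j) (suc i) A.≈ F j i
    coeff-yx F = A.trans (coeff-y (x C.* F) j (suc i)) (coeff-x F j i)

  -- The factor `t` in the recurrence makes degree m + 1 depend on degree m alone, so induction on
  -- the length identifies the candidate `Q` with the walk counts.
  Q-walks : ∀ m i j → Q j i m ≡ + walks m i j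
  Q-walks zero i j = trans (Q-recurrence j i 0) (trans (ℤₚ.+-identityʳ _) (constant i j))
    where
    constant : ∀ i j → C.1# j i 0 ≡ + walks 0 i j
    constant zero    zero    = refl
    constant (suc i) zero    = refl
    constant zero    (suc j) = refl
    constant (suc i) (suc j) = refl
  Q-walks (suc m) i j = trans (Q-recurrence j i (suc m)) (trans
    (cong₂ ℤ._+_ (constant i j) (trans (𝕋.var-⊛-suc _ m)
      (cong₂ ℤ._+_ (cong₂ ℤ._+_ (Q-walks m i (suc j)) (Q-walks m (suc i) j)) (diagonal-term i j))))
    (ℤₚ.+-identityˡ _))
    where
    constant : ∀ i j → C.1# j i (suc m) ≡ + 0
    constant zero    zero    = refl
    constant (suc i) zero    = refl
    constant zero    (suc j) = refl
    constant (suc i) (suc j) = refl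
    diagonal-term : ∀ i j → (y C.* (x C.* Q)) j i m ≡ + diagonal m i j
    diagonal-term zero    zero    = coeff-y-zero (x C.* Q) 0 m
    diagonal-term (suc i) zero    = coeff-y-zero (x C.* Q) (suc i) m
    diagonal-term zero    (suc j) = trans (coeff-y (x C.* Q) j 0 m) (coeff-x-zero Q j m)
    diagonal-term (suc i) (suc j) = trans (coeff-y (x C.* Q) j (suc i) m)
      (trans (coeff-x Q j i m) (Q-walks m i j))

  2t³-coeff : ∀ f m → (A.two A.* (t A.* (t A.* (t A.* f)))) (3 + m) ≡ f m ℤ.+ f m
  2t³-coeff f m = trans (A.double (t A.* (t A.* (t A.* f))) (3 + m)) (cong (λ a → a ℤ.+ a)
    (trans (𝕋.var-⊛-suc (t A.* (t A.* f)) (2 + m)) (trans (𝕋.var-⊛-suc (t A.* f) (1 + m)) (𝕋.var-⊛-suc f m))))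

  -- The degree is written `n * 3` because `suc n * 3` computes to `3 + n * 3`, which fits the
  -- removal of three factors `t`.
  T-coeff : ∀ n k → (T 𝕋.^ k) (n * 3) ≡ + fussCatalan k n
  T-coeff zero    zero    = refl
  T-coeff zero    (suc k) = trans (ℤₚ.*-identityˡ _) (T-coeff zero k)
  T-coeff (suc n) zero    = refl
  T-coeff (suc n) (suc k) = begin
    (T 𝕋.^ suc k) (suc n * 3)
      ≡⟨ A.ternary-power {F = T 𝕋.^ k} T-eq (suc n * 3) ⟩
    (T 𝕋.^ k) (suc n * 3) ℤ.+ (A.two A.* (A.two A.* (t A.* (t A.* (t A.* T 𝕋.^ (3 + k)))))) (suc n * 3)
      ≡⟨ cong₂ ℤ._+_ (T-coeff (suc n) k)
           (A.double (A.two A.* (t A.* (t A.* (t A.* T 𝕋.^ (3 + k))))) (suc n * 3)) ⟩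
    + fussCatalan k (suc n) ℤ.+ (term ℤ.+ term)
      ≡⟨ cong (λ a → + fussCatalan k (suc n) ℤ.+ (a ℤ.+ a)) term-eq ⟩
    + (fussCatalan k (suc n) + (b + b + (b + b)))
      ≡⟨ cong (λ a → + (fussCatalan k (suc n) + a)) (solve 1 (λ b → b :+ b :+ (b :+ b) := con 4 :* b) refl b) ⟩
    + fussCatalan (suc k) (suc n) ∎
    where
    open ≡.≡-Reasoning
    open +-*-Solver
    b = fussCatalan (3 + k) n
    term = (A.two A.* (t A.* (t A.* (t A.* T 𝕋.^ (3 + k))))) (suc n * 3)
    term-eq : term ≡ + (b + b)
    term-eq = trans (2t³-coeff (T 𝕋.^ (3 + k)) (n * 3)) (cong (λ a → a ℤ.+ a) (T-coeff n (3 + k)))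

  excursions-fussCatalan : ∀ n → walks (suc n * 3) 0 0 + 2 * fussCatalan 4 n ≡ fussCatalan 1 (suc n)
  excursions-fussCatalan n = ℤₚ.+-injective (begin
    + walks (suc n * 3) 0 0 ℤ.+ + (2 * fussCatalan 4 n)
      ≡⟨ cong₂ ℤ._+_ (sym (Q-walks (suc n * 3) 0 0)) (sym term) ⟩
    Q 0 0 (suc n * 3) ℤ.+ (A.two A.* (t A.* (t A.* (t A.* T 𝕋.^ 4)))) (suc n * 3)
      ≡⟨ A.constant-term t T (suc n * 3) ⟩
    (T 𝕋.^ 1) (suc n * 3)
      ≡⟨ T-coeff (suc n) 1 ⟩
    + fussCatalan 1 (suc n) ∎)
    where
    open ≡.≡-Reasoning
    term : (A.two A.* (t A.* (t A.* (t A.* T 𝕋.^ 4)))) (suc n * 3) ≡ + (2 * fussCatalan 4 n)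
    term = trans (2t³-coeff (T 𝕋.^ 4) (n * 3)) (trans (cong (λ a → a ℤ.+ a) (T-coeff n 4))
      (cong (λ a → + (fussCatalan 4 n + a)) (sym (ℕₚ.+-identityʳ _))))

-- Closed forms by factorials.

-- Both statements say that the number is 4ⁿ k (3n + k - 1)! / (n! (2n + k)!). The factorial (3n + k
-- - 1)! needs n > 0 or k > 0: this version takes n > 0 and so admits the base k = 0 of the
-- induction on k, the next one takes k > 0 and admits n = 0.
fussCatalan-suc : ∀ n k →
  fussCatalan k (suc n) * (suc n ! * (suc n * 2 + k) !) ≡ 4 ^ suc n * (k * (2 + n * 3 + k) !)
fussCatalan-closed : ∀ n k →
  fussCatalan (suc k) n * (n ! * (n * 2 + suc k) !) ≡ 4 ^ n * (suc k * (n * 3 + k) !)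

fussCatalan-suc n zero    = sym (ℕₚ.*-zeroʳ (4 ^ suc n))
fussCatalan-suc n (suc k) = begin
  (a + 4 * b) * (suc n ! * (suc n * 2 + suc k) !)
    ≡⟨ cong (λ d → (a + 4 * b) * (suc n ! * d !)) (ℕₚ.+-suc (suc n * 2) k) ⟩
  (a + 4 * b) * (suc n * n ! * (suc M * M !))
    ≡⟨ solve 6 (λ a b n f M g →
         (a :+ con 4 :* b) :* ((con 1 :+ n) :* f :* ((con 1 :+ M) :* g))
      := (con 1 :+ M) :* (a :* ((con 1 :+ n) :* f :* g)) :+ con 4 :* (con 1 :+ n) :* (b :* (f :* ((con 1 :+ M) :* g))))
         refl a b n (n !) M (M !) ⟩
  suc M * (a * (suc n ! * M !)) + 4 * suc n * (b * (n ! * suc M !))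
    ≡⟨ cong₂ (λ p r → suc M * p + 4 * suc n * r) (fussCatalan-suc n k) b-closed ⟩
  suc M * (4 ^ suc n * (k * X !)) + 4 * suc n * (4 ^ n * ((3 + k) * X !))
    -- Up to common factors: k(2n + 3 + k) + (n + 1)(k + 3) = (k + 1)(3n + 3 + k).
    ≡⟨ solve 4 (λ n k p f →
         (con 3 :+ n :* con 2 :+ k) :* (con 4 :* p :* (k :* f)) :+ con 4 :* (con 1 :+ n) :* (p :* ((con 3 :+ k) :* f))
      := con 4 :* p :* ((con 1 :+ k) :* ((con 3 :+ n :* con 3 :+ k) :* f))) refl n k (4 ^ n) (X !) ⟩
  4 ^ suc n * (suc k * suc X !)
    ≡⟨ cong (λ d → 4 ^ suc n * (suc k * d !)) (ℕₚ.+-suc (2 + n * 3) k) ⟨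
  4 ^ suc n * (suc k * (2 + n * 3 + suc k) !) ∎
  where
  open ≡.≡-Reasoning
  open +-*-Solver
  a = fussCatalan k (suc n)
  b = fussCatalan (3 + k) n
  M = suc n * 2 + k
  X = 2 + n * 3 + k
  b-closed : b * (n ! * suc M !) ≡ 4 ^ n * ((3 + k) * X !)
  b-closed = ≡.subst₂ (λ d e → b * (n ! * d !) ≡ 4 ^ n * ((3 + k) * e !))
    (solve 2 (λ n k → n :* con 2 :+ (con 3 :+ k) := con 3 :+ n :* con 2 :+ k) refl n k)
    (solve 2 (λ n k → n :* con 3 :+ (con 2 :+ k) := con 2 :+ n :* con 3 :+ k) refl n k)
    (fussCatalan-closed n (2 + k))

fussCatalan-closed zero    k = cong (λ d → d + 0) (ℕₚ.*-identityˡ _)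
fussCatalan-closed (suc n) k =
  ≡.subst (λ d → fussCatalan (suc k) (suc n) * (suc n ! * (suc n * 2 + suc k) !) ≡ 4 ^ suc n * (suc k * d !))
    (ℕₚ.+-suc (2 + n * 3) k) (fussCatalan-suc n (suc k))

-- For `suc n`, after scaling by the factorials, `fussCatalan 1 (suc n)` amounts to n + 2 copies of
-- the right-hand side and `2 * fussCatalan 4 n` to n + 1 copies, so the difference is one copy.
excursions-closed : ∀ n → walks (n * 3) 0 0 * ((n + 1) ! * (n * 2 + 1) !) ≡ 4 ^ n * (n * 3) !
excursions-closed zero    = refl
excursions-closed (suc n) = ℕₚ.+-cancelʳ-≡ (2 * b * ((suc n + 1) ! * D !)) _ _ (begin
  w * ((suc n + 1) ! * D !) + 2 * b * ((suc n + 1) ! * D !)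
    ≡⟨ ℕₚ.*-distribʳ-+ ((suc n + 1) ! * D !) w (2 * b) ⟨
  (w + 2 * b) * ((suc n + 1) ! * D !)
    ≡⟨ cong₂ (λ p r → p * (r ! * D !)) (Kreweras.excursions-fussCatalan n) (ℕₚ.+-comm (suc n) 1) ⟩
  f * ((2 + n) * suc n ! * D !)
    ≡⟨ solve 4 (λ f n p d → f :* ((con 2 :+ n) :* p :* d) := (con 2 :+ n) :* (f :* (p :* d))) refl f n (suc n !) (D !) ⟩
  (2 + n) * (f * (suc n ! * D !))
    ≡⟨ cong ((2 + n) *_) (fussCatalan-closed (suc n) 0) ⟩
  (2 + n) * (4 ^ suc n * (1 * (suc n * 3 + 0) !))
    ≡⟨ cong (λ d → (2 + n) * (4 ^ suc n * (1 * d !))) (ℕₚ.+-identityʳ (suc n * 3)) ⟩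
  (2 + n) * (4 ^ suc n * (1 * (suc n * 3) !))
    ≡⟨ solve 3 (λ n p g → (con 2 :+ n) :* (con 4 :* p :* (con 1 :* g))
         := con 4 :* p :* g :+ (con 1 :+ n) :* (p :* (con 4 :* g))) refl n (4 ^ n) ((suc n * 3) !) ⟩
  4 ^ suc n * (suc n * 3) ! + suc n * (4 ^ n * (4 * (suc n * 3) !))
    ≡⟨ cong (λ d → 4 ^ suc n * (suc n * 3) ! + suc n * d) b-closed ⟨
  4 ^ suc n * (suc n * 3) ! + suc n * (b * (n ! * ((4 + n * 2) * D !)))
    ≡⟨ solve 5 (λ r n b p d → r :+ (con 1 :+ n) :* (b :* (p :* ((con 4 :+ n :* con 2) :* d)))
         := r :+ con 2 :* b :* ((con 2 :+ n) :* ((con 1 :+ n) :* p) :* d)) refl (4 ^ suc n * (suc n * 3) !) n b (n !) (D !) ⟩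
  4 ^ suc n * (suc n * 3) ! + 2 * b * ((2 + n) ! * D !)
    ≡⟨ cong (λ d → 4 ^ suc n * (suc n * 3) ! + 2 * b * (d ! * D !)) (ℕₚ.+-comm 1 (suc n)) ⟩
  4 ^ suc n * (suc n * 3) ! + 2 * b * ((suc n + 1) ! * D !) ∎)
  where
  open ≡.≡-Reasoning
  open +-*-Solver
  w = walks (suc n * 3) 0 0
  f = fussCatalan 1 (suc n)
  b = fussCatalan 4 n
  D = suc n * 2 + 1
  b-closed : b * (n ! * ((4 + n * 2) * D !)) ≡ 4 ^ n * (4 * (suc n * 3) !)
  b-closed = ≡.subst₂ (λ d e → b * (n ! * d) ≡ 4 ^ n * (4 * e !))
    -- The first rewriting exposes a successor so that (2n + 4)! unfolds to a multiple of `D !`; the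
    -- second tidies the factor split off.
    (trans (cong _! (solve 1 (λ n → n :* con 2 :+ con 4 := con 1 :+ (con 2 :+ n :* con 2 :+ con 1)) refl n))
      (cong (_* D !) (solve 1 (λ n → con 1 :+ (con 2 :+ n :* con 2 :+ con 1) := con 4 :+ n :* con 2) refl n)))
    (ℕₚ.+-comm (n * 3) 3)
    (fussCatalan-closed n 3)

-- Walks that record the labels of their steps.

open import Data.Sum using (inj₁; inj₂)
open import Data.Unit using (tt)
open import Data.Vec using ([]; _∷_; toList)
open import Data.List using (List; []; _∷_; _++_; length; map; drop; reverse; applyDownFrom)
import Data.List.Properties as Listₚ
open import Data.List.Membership.Propositional using (_∈_)
open import Data.List.Membership.Propositional.Properties
  using (∈-map⁺; ∈-map⁻; ∈-++⁺ˡ; ∈-++⁺ʳ; ∈-++⁻; ∈-applyDownFrom⁺; ∈-applyDownFrom⁻)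
open import Data.List.Membership.Propositional.Properties.WithK using (unique∧set⇒bag)
open import Data.List.Relation.Binary.BagAndSetEquality using (∼bag⇒↭)
open import Data.List.Relation.Binary.Disjoint.Propositional using (Disjoint)
open import Data.List.Relation.Binary.Permutation.Propositional
  using (_↭_; ↭-refl; ↭-sym; ↭-trans; ↭-prep; ↭⇒↭ₛ)
import Data.List.Relation.Binary.Permutation.Propositional.Properties as ↭ₚ
import Data.List.Relation.Binary.Permutation.Setoid.Properties as ↭ₛ
open import Data.List.Relation.Binary.Pointwise using (Pointwise; []; _∷_)
import Data.List.Relation.Binary.Pointwise as Pointwise
open import Data.List.Relation.Unary.All as All using (All; []; _∷_)
import Data.List.Relation.Unary.All.Properties as Allₚ
open import Data.List.Relation.Unary.AllPairs as AllPairs using (AllPairs; []; _∷_)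
import Data.List.Relation.Unary.AllPairs.Properties as AllPairsₚ
open import Data.List.Relation.Unary.Any using (here; there)
open import Data.List.Relation.Unary.Linked using (Linked; []; [-]; _∷_)
open import Data.List.Relation.Unary.Linked.Properties using (Linked⇒AllPairs)
open import Data.List.Relation.Unary.Unique.Propositional using (Unique)
import Data.List.Relation.Unary.Unique.Propositional.Properties as Uniqueₚ
open import Function.Bundles using (_⇔_; mk⇔)
open import Relation.Binary.Core using (Rel)
open import Relation.Nullary using (¬_; contradiction)

-- The labels of the roots, left children and right children, each in decreasing order.
State : Set
State = List ℕ × List ℕ × List ℕ

pushA pushB pushC : ℕ → State → State
pushA k (as , bs , cs) = k ∷ as , bs , cs
pushB k (as , bs , cs) = as , k ∷ bs , cs
pushC k (as , bs , cs) = as , bs , k ∷ cs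

-- Labels arrive in increasing order, so each list decreases from its latest label. The coordinates
-- count the roots still waiting for a left and for a right child.
data Walk : ℕ → ℕ → ℕ → State → Set where
  start : Walk 0 0 0 ([] , [] , [])
  stepA : ∀ {m i j s} → Walk m i j s → Walk (suc m) (suc i) (suc j) (pushA (suc m) s)
  stepB : ∀ {m i j s} → Walk m (suc i) j s → Walk (suc m) i j (pushB (suc m) s)
  stepC : ∀ {m i j s} → Walk m i (suc j) s → Walk (suc m) i j (pushC (suc m) s)

states : ℕ → ℕ → ℕ → List State
statesA : ℕ → ℕ → ℕ → List State

states zero    zero zero = ([] , [] , []) ∷ []
states zero    _    _    = []
states (suc m) i    j    =
  (map (pushC (suc m)) (states m i (suc j)) ++ map (pushB (suc m)) (states m (suc i) j)) ++ statesA m i j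

statesA m (suc i) (suc j) = map (pushA (suc m)) (states m i j)
statesA m _       _       = []

length-states : ∀ m i j → length (states m i j) ≡ walks m i j
length-statesA : ∀ m i j → length (statesA m i j) ≡ diagonal m i j

length-states zero zero    zero    = refl
length-states zero zero    (suc j) = refl
length-states zero (suc i) j       = refl
length-states (suc m) i j = begin
  length ((Cs ++ Bs) ++ As)
    ≡⟨ Listₚ.length-++ (Cs ++ Bs) ⟩
  length (Cs ++ Bs) + length As
    ≡⟨ cong (_+ length As) (Listₚ.length-++ Cs) ⟩
  length Cs + length Bs + length As
    ≡⟨ cong₂ _+_ (cong₂ _+_ (trans (Listₚ.length-map _ (states m i (suc j))) (length-states m i (suc j)))
                            (trans (Listₚ.length-map _ (states m (suc i) j)) (length-states m (suc i) j)))
                 (length-statesA m i j) ⟩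
  walks (suc m) i j ∎
  where
  open ≡.≡-Reasoning
  As = statesA m i j
  Bs = map (pushB (suc m)) (states m (suc i) j)
  Cs = map (pushC (suc m)) (states m i (suc j))

length-statesA m zero    j       = refl
length-statesA m (suc i) zero    = refl
length-statesA m (suc i) (suc j) = trans (Listₚ.length-map _ (states m i j)) (length-states m i j)

Walk⇒∈ : ∀ {m i j s} → Walk m i j s → s ∈ states m i j
Walk⇒∈ start     = here refl
Walk⇒∈ (stepA w) = ∈-++⁺ʳ _ (∈-map⁺ (pushA (suc _)) (Walk⇒∈ w))
Walk⇒∈ (stepB {m} {i} {j} w) = ∈-++⁺ˡ (∈-++⁺ʳ (map (pushC (suc m)) (states m i (suc j))) (∈-map⁺ (pushB (suc _)) (Walk⇒∈ w)))
Walk⇒∈ (stepC w) = ∈-++⁺ˡ (∈-++⁺ˡ (∈-map⁺ (pushC (suc _)) (Walk⇒∈ w)))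

∈⇒Walk : ∀ m i j {s} → s ∈ states m i j → Walk m i j s
∈⇒Walk zero zero zero (here refl) = start
∈⇒Walk (suc m) i j s∈ with ∈-++⁻ (map (pushC (suc m)) (states m i (suc j)) ++ _) s∈
∈⇒Walk (suc m) (suc i) (suc j) _ | inj₂ s∈ with _ , s′∈ , refl ← ∈-map⁻ _ s∈ = stepA (∈⇒Walk m i j s′∈)
∈⇒Walk (suc m) i j _ | inj₁ s∈ with ∈-++⁻ (map (pushC (suc m)) (states m i (suc j))) s∈
... | inj₁ c∈ with _ , s′∈ , refl ← ∈-map⁻ _ c∈ = stepC (∈⇒Walk m i (suc j) s′∈)
... | inj₂ b∈ with _ , s′∈ , refl ← ∈-map⁻ _ b∈ = stepB (∈⇒Walk m (suc i) j s′∈)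

Walk-bounded : ∀ {m i j as bs cs} → Walk m i j (as , bs , cs) → All (_≤ m) as × All (_≤ m) bs × All (_≤ m) cs
Walk-bounded start = [] , [] , []
Walk-bounded {suc m} (stepA w) with as , bs , cs ← Walk-bounded w =
  ℕₚ.≤-refl ∷ All.map ℕₚ.m≤n⇒m≤1+n as , All.map ℕₚ.m≤n⇒m≤1+n bs , All.map ℕₚ.m≤n⇒m≤1+n cs
Walk-bounded {suc m} (stepB w) with as , bs , cs ← Walk-bounded w =
  All.map ℕₚ.m≤n⇒m≤1+n as , ℕₚ.≤-refl ∷ All.map ℕₚ.m≤n⇒m≤1+n bs , All.map ℕₚ.m≤n⇒m≤1+n cs
Walk-bounded {suc m} (stepC w) with as , bs , cs ← Walk-bounded w =
  All.map ℕₚ.m≤n⇒m≤1+n as , All.map ℕₚ.m≤n⇒m≤1+n bs , ℕₚ.≤-refl ∷ All.map ℕₚ.m≤n⇒m≤1+n cs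

-- The last step can be read off a state: `suc m` lies only in the list just extended, since all
-- earlier labels are at most `m`.
states-unique : ∀ m i j → Unique (states m i j)
statesA-unique : ∀ m i j → Unique (statesA m i j)

states-unique zero zero    zero    = [] ∷ []
states-unique zero zero    (suc j) = []
states-unique zero (suc i) j       = []
states-unique (suc m) i j =
  Uniqueₚ.++⁺ (Uniqueₚ.++⁺ (Uniqueₚ.map⁺ (λ { refl → refl }) (states-unique m i (suc j)))
                           (Uniqueₚ.map⁺ (λ { refl → refl }) (states-unique m (suc i) j)) C#B)
              (statesA-unique m i j) (CB#A i j)
  where
  C#B : Disjoint (map (pushC (suc m)) (states m i (suc j))) (map (pushB (suc m)) (states m (suc i) j))
  C#B (c∈ , b∈) with ∈-map⁻ _ c∈ | ∈-map⁻ _ b∈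
  ... | _ , s∈ , refl | _ , s′∈ , refl with _ , _ , 1+m≤m ∷ _ ← Walk-bounded (∈⇒Walk m (suc i) j s′∈) =
    ℕₚ.1+n≰n 1+m≤m
  CB#A : ∀ i j → Disjoint (map (pushC (suc m)) (states m i (suc j)) ++ map (pushB (suc m)) (states m (suc i) j))
                          (statesA m i j)
  CB#A (suc i) (suc j) (cb∈ , a∈) with ∈-map⁻ _ a∈ | ∈-++⁻ (map (pushC (suc m)) (states m (suc i) (2 + j))) cb∈
  ... | _ , s∈ , refl | inj₁ c∈ with _ , s′∈ , refl ← ∈-map⁻ _ c∈
                               with 1+m≤m ∷ _ , _ ← Walk-bounded (∈⇒Walk m (suc i) (2 + j) s′∈) = ℕₚ.1+n≰n 1+m≤m
  ... | _ , s∈ , refl | inj₂ b∈ with _ , s′∈ , refl ← ∈-map⁻ _ b∈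
                               with 1+m≤m ∷ _ , _ ← Walk-bounded (∈⇒Walk m (2 + i) (suc j) s′∈) = ℕₚ.1+n≰n 1+m≤m

statesA-unique m zero    j       = []
statesA-unique m (suc i) zero    = []
statesA-unique m (suc i) (suc j) = Uniqueₚ.map⁺ (λ { refl → refl }) (states-unique m i j)

-- Which triples of lists come from walks.

-- The lists decrease, so dropping the i largest roots aligns the others with their left children.
record Valid (m i j : ℕ) (as bs cs : List ℕ) : Set where
  field
    desc-a  : AllPairs _>_ as
    desc-b  : AllPairs _>_ bs
    desc-c  : AllPairs _>_ cs
    perm    : as ++ bs ++ cs ↭ applyDownFrom suc m
    len-b   : length as ≡ i + length bs
    len-c   : length as ≡ j + length cs
    below-b : Pointwise _<_ (drop i as) bs
    below-c : Pointwise _<_ (drop j as) cs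

  bounded : All (_≤ m) (as ++ bs ++ cs)
  bounded = ↭ₚ.All-resp-↭ (↭-sym perm) (Allₚ.applyDownFrom⁺₁ suc m (λ i<m → i<m))

  bounded-a : All (_≤ m) as
  bounded-a = Allₚ.++⁻ˡ as bounded

  bounded-b : All (_≤ m) bs
  bounded-b = Allₚ.++⁻ˡ bs (Allₚ.++⁻ʳ as bounded)

  bounded-c : All (_≤ m) cs
  bounded-c = Allₚ.++⁻ʳ bs (Allₚ.++⁻ʳ as bounded)

shift-b : ∀ k (as bs cs : List ℕ) → as ++ (k ∷ bs) ++ cs ↭ k ∷ as ++ bs ++ cs
shift-b k as bs cs = ↭ₚ.shift k as (bs ++ cs)

shift-c : ∀ k (as bs cs : List ℕ) → as ++ bs ++ (k ∷ cs) ↭ k ∷ as ++ bs ++ cs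
shift-c k as bs cs = ↭-trans (↭ₚ.++⁺ˡ as (↭ₚ.shift k bs cs)) (↭ₚ.shift k as (bs ++ cs))

-- Lowering the drop by one exposes the smallest root without a child of this kind; the new child
-- `k` is matched with it and exceeds every root present.
below-∷ : ∀ i {as bs k l} → length as ≡ suc i + l → All (_< k) as →
  Pointwise _<_ (drop (suc i) as) bs → Pointwise _<_ (drop i as) (k ∷ bs)
below-∷ zero    {a ∷ as} eq (a<k ∷ _)  p = a<k ∷ p
below-∷ (suc i) {a ∷ as} eq (_ ∷ as<k) p = below-∷ i (ℕₚ.suc-injective eq) as<k p

below-tail : ∀ i {as bs k} → Pointwise _<_ (drop i as) (k ∷ bs) → Pointwise _<_ (drop (suc i) as) bs
below-tail zero    {a ∷ as} (_ ∷ p) = p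
below-tail (suc i) {a ∷ as} p       = below-tail i p

Walk⇒Valid : ∀ {m i j as bs cs} → Walk m i j (as , bs , cs) → Valid m i j as bs cs
Walk⇒Valid start = record
  { desc-a = [] ; desc-b = [] ; desc-c = [] ; perm = ↭-refl ; len-b = refl ; len-c = refl
  ; below-b = [] ; below-c = [] }
Walk⇒Valid (stepA w) = record
  { desc-a = All.map s≤s bounded-a ∷ desc-a ; desc-b = desc-b ; desc-c = desc-c
  ; perm = ↭-prep _ perm ; len-b = cong suc len-b ; len-c = cong suc len-c
  ; below-b = below-b ; below-c = below-c }
  where open Valid (Walk⇒Valid w)
Walk⇒Valid (stepB {i = i} {s = as , bs , cs} w) = record
  { desc-a = desc-a ; desc-b = All.map s≤s bounded-b ∷ desc-b ; desc-c = desc-c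
  ; perm = ↭-trans (shift-b _ as bs cs) (↭-prep _ perm)
  ; len-b = trans len-b (sym (ℕₚ.+-suc i _)) ; len-c = len-c
  ; below-b = below-∷ i len-b (All.map s≤s bounded-a) below-b ; below-c = below-c }
  where open Valid (Walk⇒Valid w)
Walk⇒Valid (stepC {j = j} {s = as , bs , cs} w) = record
  { desc-a = desc-a ; desc-b = desc-b ; desc-c = All.map s≤s bounded-c ∷ desc-c
  ; perm = ↭-trans (shift-c _ as bs cs) (↭-prep _ perm)
  ; len-b = len-b ; len-c = trans len-c (sym (ℕₚ.+-suc j _))
  ; below-b = below-b ; below-c = below-∷ j len-c (All.map s≤s bounded-a) below-c }
  where open Valid (Walk⇒Valid w)

head-max : ∀ {k xs} → k ∈ xs → All (_≤ k) xs → AllPairs _>_ xs → ∃ λ ys → xs ≡ k ∷ ys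
head-max (here refl) _         _         = _ , refl
head-max (there k∈)  (x≤k ∷ _) (x>∷ ∷ _) = contradiction (All.lookup x>∷ k∈) (ℕₚ.≤⇒≯ x≤k)

-- This keeps walks in the quadrant: if the largest label is a root but no root is waiting, that
-- root would need a still larger child.
not-below : ∀ {k as bs} → All (_≤ k) bs → ¬ Pointwise _<_ (k ∷ as) bs
not-below (b≤k ∷ _) (k<b ∷ _) = ℕₚ.<⇒≱ k<b b≤k

-- The largest label heads one of the three decreasing lists; which one determines the last step,
-- and removing it leaves a valid triple.
Valid⇒Walk : ∀ m {i j} as bs cs → Valid m i j as bs cs → Walk m i j (as , bs , cs)
Valid⇒Walk zero {i} {j} [] [] [] v
  with refl ← ℕₚ.m+n≡0⇒m≡0 i (sym (Valid.len-b v)) | refl ← ℕₚ.m+n≡0⇒m≡0 j (sym (Valid.len-c v)) = start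
Valid⇒Walk zero (_ ∷ _) _ _ v = contradiction (↭ₚ.↭-empty-inv (Valid.perm v)) (λ ())
Valid⇒Walk zero [] (_ ∷ _) _ v = contradiction (↭ₚ.↭-empty-inv (Valid.perm v)) (λ ())
Valid⇒Walk zero [] [] (_ ∷ _) v = contradiction (↭ₚ.↭-empty-inv (Valid.perm v)) (λ ())
Valid⇒Walk (suc m) as bs cs v with ∈-++⁻ as (↭ₚ.∈-resp-↭ (↭-sym (Valid.perm v)) (here refl))
Valid⇒Walk (suc m) {i} {j} as bs cs v | inj₁ a∈ with head-max a∈ (Valid.bounded-a v) (Valid.desc-a v)
Valid⇒Walk (suc m) {zero} {j} _ bs cs v | inj₁ _ | as , refl =
  contradiction (Valid.below-b v) (not-below (Valid.bounded-b v))
Valid⇒Walk (suc m) {suc i} {zero} _ bs cs v | inj₁ _ | as , refl =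
  contradiction (Valid.below-c v) (not-below (Valid.bounded-c v))
Valid⇒Walk (suc m) {suc i} {suc j} _ bs cs v | inj₁ _ | as , refl = stepA (Valid⇒Walk m as bs cs record
  { desc-a = AllPairs.tail desc-a ; desc-b = desc-b ; desc-c = desc-c ; perm = ↭ₚ.drop-∷ perm
  ; len-b = ℕₚ.suc-injective len-b ; len-c = ℕₚ.suc-injective len-c
  ; below-b = below-b ; below-c = below-c })
  where open Valid v
Valid⇒Walk (suc m) as bs cs v | inj₂ bc∈ with ∈-++⁻ bs bc∈
Valid⇒Walk (suc m) as bs cs v | inj₂ bc∈ | inj₁ b∈ with head-max b∈ (Valid.bounded-b v) (Valid.desc-b v)
Valid⇒Walk (suc m) {i} as _ cs v | inj₂ bc∈ | inj₁ b∈ | bs , refl = stepB (Valid⇒Walk m as bs cs record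
  { desc-a = desc-a ; desc-b = AllPairs.tail desc-b ; desc-c = desc-c
  ; perm = ↭ₚ.drop-∷ (↭-trans (↭-sym (shift-b _ as bs cs)) perm)
  ; len-b = trans len-b (ℕₚ.+-suc i _) ; len-c = len-c
  ; below-b = below-tail i below-b ; below-c = below-c })
  where open Valid v
Valid⇒Walk (suc m) as bs cs v | inj₂ bc∈ | inj₂ c∈ with head-max c∈ (Valid.bounded-c v) (Valid.desc-c v)
Valid⇒Walk (suc m) {i} {j} as bs _ v | inj₂ bc∈ | inj₂ c∈ | cs , refl = stepC (Valid⇒Walk m as bs cs record
  { desc-a = desc-a ; desc-b = desc-b ; desc-c = AllPairs.tail desc-c
  ; perm = ↭ₚ.drop-∷ (↭-trans (↭-sym (shift-c _ as bs cs)) perm)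
  ; len-b = len-b ; len-c = trans len-c (ℕₚ.+-suc j _)
  ; below-b = below-b ; below-c = below-tail j below-c })
  where open Valid v

-- Forests and their columns.

roots lefts rights : ∀ {n} → Forest n → List ℕ
roots  F = map proj₁ (toList F)
lefts  F = map (proj₁ ∘ proj₂) (toList F)
rights F = map (proj₂ ∘ proj₂) (toList F)

-- In an increasing forest all three columns increase, so reversal gives the decreasing lists of a
-- `State`, and reversing again restores which labels share a shrub.
fromForest : ∀ {n} → Forest n → State
fromForest F = reverse (roots F) , reverse (lefts F) , reverse (rights F)

-- The last clause is junk: it is only reached when a list has fewer than n entries.
zipForest : ∀ n → List ℕ → List ℕ → List ℕ → Forest n
zipForest zero    _        _        _        = []
zipForest (suc n) (a ∷ as) (b ∷ bs) (c ∷ cs) = (a , b , c) ∷ zipForest n as bs cs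
zipForest (suc n) _        _        _        = (0 , 0 , 0) ∷ zipForest n [] [] []

toForest : ∀ n → State → Forest n
toForest n (as , bs , cs) = zipForest n (reverse as) (reverse bs) (reverse cs)

zipForest-columns : ∀ {n} (F : Forest n) → zipForest n (roots F) (lefts F) (rights F) ≡ F
zipForest-columns []      = refl
zipForest-columns (s ∷ F) = cong (s ∷_) (zipForest-columns F)

columns-zipForest : ∀ {n} as bs cs → length as ≡ n → length bs ≡ n → length cs ≡ n →
  let F = zipForest n as bs cs in roots F ≡ as × lefts F ≡ bs × rights F ≡ cs
columns-zipForest [] [] [] refl _ _ = refl , refl , refl
columns-zipForest (a ∷ as) (b ∷ bs) (c ∷ cs) refl eq eq′
  with p , q , r ← columns-zipForest as bs cs refl (ℕₚ.suc-injective eq) (ℕₚ.suc-injective eq′) =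
  cong (a ∷_) p , cong (b ∷_) q , cong (c ∷_) r

toForest-fromForest : ∀ {n} (F : Forest n) → toForest n (fromForest F) ≡ F
toForest-fromForest {n} F
  rewrite Listₚ.reverse-involutive (roots F) | Listₚ.reverse-involutive (lefts F) | Listₚ.reverse-involutive (rights F) =
  zipForest-columns F

fromForest-toForest : ∀ {n as bs cs} → length as ≡ n → length bs ≡ n → length cs ≡ n →
  fromForest (toForest n (as , bs , cs)) ≡ (as , bs , cs)
fromForest-toForest {n} {as} {bs} {cs} p q r
  with a-eq , b-eq , c-eq ← columns-zipForest {n} (reverse as) (reverse bs) (reverse cs)
    (trans (Listₚ.length-reverse as) p) (trans (Listₚ.length-reverse bs) q) (trans (Listₚ.length-reverse cs) r) =
  cong₂ _,_ (restore a-eq) (cong₂ _,_ (restore b-eq) (restore c-eq))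
  where
  restore : ∀ {xs ys : List ℕ} → xs ≡ reverse ys → reverse xs ≡ ys
  restore {ys = ys} refl = Listₚ.reverse-involutive ys

reverse-AllPairs : ∀ {R : Rel ℕ 0ℓ} {xs} → AllPairs R xs → AllPairs (flip R) (reverse xs)
reverse-AllPairs []                   = []
reverse-AllPairs {xs = x ∷ xs} (px ∷ pxs) rewrite Listₚ.unfold-reverse x xs =
  AllPairsₚ.++⁺ (reverse-AllPairs pxs) ([] ∷ [])
    (↭ₚ.All-resp-↭ (↭-sym (↭ₚ.↭-reverse xs)) (All.map (_∷ []) px))

<L-trans : ∀ {s t u} → s <L t → t <L u → s <L u
<L-trans (p , q , r) (p′ , q′ , r′) = ℕₚ.<-trans p p′ , ℕₚ.<-trans q q′ , ℕₚ.<-trans r r′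

Increasing⇒AllPairs : ∀ {n} {F : Forest n} → Increasing F → AllPairs _<L_ (toList F)
Increasing⇒AllPairs = Linked⇒AllPairs (λ {s} {t} {u} → <L-trans {s} {t} {u}) ∘ linked
  where
  linked : ∀ {n} {F : Forest n} → Increasing F → Linked _<L_ (toList F)
  linked inc-[]       = []
  linked inc-[-]      = [-]
  linked (inc-∷ p ps) = p ∷ linked ps

AllPairs⇒Increasing : ∀ {n} (F : Forest n) →
  AllPairs _<_ (roots F) → AllPairs _<_ (lefts F) → AllPairs _<_ (rights F) → Increasing F
AllPairs⇒Increasing []          _ _ _ = inc-[]
AllPairs⇒Increasing (s ∷ [])    _ _ _ = inc-[-]
AllPairs⇒Increasing (s ∷ t ∷ F) ((p ∷ _) ∷ ps) ((q ∷ _) ∷ qs) ((r ∷ _) ∷ rs) =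
  inc-∷ (p , q , r) (AllPairs⇒Increasing (t ∷ F) ps qs rs)

AllShrubs⇒Pointwise : ∀ {n} (F : Forest n) → AllShrubs F →
  Pointwise _<_ (roots F) (lefts F) × Pointwise _<_ (roots F) (rights F)
AllShrubs⇒Pointwise []      _ = [] , []
AllShrubs⇒Pointwise (s ∷ F) ((p , q) , ss) with ps , qs ← AllShrubs⇒Pointwise F ss = p ∷ ps , q ∷ qs

Pointwise⇒AllShrubs : ∀ {n} (F : Forest n) →
  Pointwise _<_ (roots F) (lefts F) → Pointwise _<_ (roots F) (rights F) → AllShrubs F
Pointwise⇒AllShrubs []      _        _        = tt
Pointwise⇒AllShrubs (s ∷ F) (p ∷ ps) (q ∷ qs) = (p , q) , Pointwise⇒AllShrubs F ps qs

labels-↭ : ∀ {n} (F : Forest n) → labels F ↭ roots F ++ lefts F ++ rights F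
labels-↭ [] = ↭-refl
labels-↭ ((a , b , c) ∷ F) = ↭-prep a (↭-sym (↭-trans (shift-b b (roots F) (lefts F) (c ∷ rights F))
  (↭-prep b (↭-trans (shift-c c (roots F) (lefts F) (rights F)) (↭-prep c (↭-sym (labels-↭ F)))))))

fromForest-↭ : ∀ {n} (F : Forest n) → reverse (roots F) ++ reverse (lefts F) ++ reverse (rights F) ↭ labels F
fromForest-↭ F = ↭-trans
  (↭ₚ.++⁺ (↭ₚ.↭-reverse (roots F)) (↭ₚ.++⁺ (↭ₚ.↭-reverse (lefts F)) (↭ₚ.↭-reverse (rights F))))
  (↭-sym (labels-↭ F))

-- Label sets, and increasing forests as excursions.

∈-labelRange⁻ : ∀ {m k} → k ∈ applyDownFrom suc m → 1 ≤ k × k ≤ m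
∈-labelRange⁻ k∈ with _ , i<m , refl ← ∈-applyDownFrom⁻ suc k∈ = s≤s z≤n , i<m

∈-labelRange⁺ : ∀ {m k} → 1 ≤ k → k ≤ m → k ∈ applyDownFrom suc m
∈-labelRange⁺ {k = suc k} _ k≤m = ∈-applyDownFrom⁺ suc k≤m

labelRange-unique : ∀ m → Unique (applyDownFrom suc m)
labelRange-unique m = Uniqueₚ.applyDownFrom⁺₁ suc m (λ j<i _ eq → ℕₚ.<⇒≢ (s≤s j<i) (sym eq))

-- Two duplicate-free lists with the same members are equal as bags.
HasLabelSet⇒↭ : ∀ {n m} (F : Forest n) → HasLabelSet m F → labels F ↭ applyDownFrom suc m
HasLabelSet⇒↭ {m = m} F (unique , within , covers) = ∼bag⇒↭ (unique∧set⇒bag unique (labelRange-unique m)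
  (λ {k} → mk⇔ (λ k∈ → ∈-labelRange⁺ (proj₁ (within k k∈)) (proj₂ (within k k∈)))
               (λ k∈ → covers k (proj₁ (∈-labelRange⁻ k∈)) (proj₂ (∈-labelRange⁻ k∈)))))

↭⇒HasLabelSet : ∀ {n m} (F : Forest n) → labels F ↭ applyDownFrom suc m → HasLabelSet m F
↭⇒HasLabelSet {m = m} F p =
  ↭ₛ.Unique-resp-↭ (≡.setoid ℕ) (↭⇒↭ₛ (↭-sym p)) (labelRange-unique m) ,
  (λ k k∈ → ∈-labelRange⁻ (↭ₚ.∈-resp-↭ p k∈)) ,
  (λ k 1≤k k≤m → ↭ₚ.∈-resp-↭ (↭-sym p) (∈-labelRange⁺ 1≤k k≤m))

IsILF⇒Walk : ∀ {n} (F : Forest n) → IsILF n F → Walk (3 * n) 0 0 (fromForest F)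
IsILF⇒Walk F (shrubs , labelSet , inc) with below-l , below-r ← AllShrubs⇒Pointwise F shrubs =
  Valid⇒Walk _ _ _ _ record
    { desc-a = column proj₁
    ; desc-b = column (proj₁ ∘ proj₂)
    ; desc-c = column (proj₂ ∘ proj₂)
    ; perm = ↭-trans (fromForest-↭ F) (HasLabelSet⇒↭ F labelSet)
    ; len-b = Pointwise.Pointwise-length (Pointwise.reverse⁺ below-l)
    ; len-c = Pointwise.Pointwise-length (Pointwise.reverse⁺ below-r)
    ; below-b = Pointwise.reverse⁺ below-l
    ; below-c = Pointwise.reverse⁺ below-r
    }
  where
  column : ∀ {f} → (∀ {s t} → s <L t → f s < f t) → AllPairs _>_ (reverse (map f (toList F)))
  column mono = reverse-AllPairs (AllPairsₚ.map⁺ (AllPairs.map (λ {s} {t} → mono {s} {t}) (Increasing⇒AllPairs inc)))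

Walk⇒IsILF : ∀ {n} (F : Forest n) → Walk (3 * n) 0 0 (fromForest F) → IsILF n F
Walk⇒IsILF F w =
  Pointwise⇒AllShrubs F (unreverse-below (lefts F) below-b) (unreverse-below (rights F) below-c) ,
  ↭⇒HasLabelSet F (↭-trans (↭-sym (fromForest-↭ F)) perm) ,
  AllPairs⇒Increasing F (unreverse desc-a) (unreverse desc-b) (unreverse desc-c)
  where
  open Valid (Walk⇒Valid w)
  unreverse : ∀ {xs} → AllPairs _>_ (reverse xs) → AllPairs _<_ xs
  unreverse {xs} p = subst (AllPairs _<_) (Listₚ.reverse-involutive xs) (reverse-AllPairs p)
  unreverse-below : ∀ ys → Pointwise _<_ (reverse (roots F)) (reverse ys) → Pointwise _<_ (roots F) ys
  unreverse-below ys p = ≡.subst₂ (Pointwise _<_) (Listₚ.reverse-involutive (roots F)) (Listₚ.reverse-involutive ys)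
    (Pointwise.reverse⁺ p)

-- Ending at the origin makes the lists equally long, and together they hold 3n labels. This keeps
-- `zipForest` away from its junk clause.
Walk-lengths : ∀ {n as bs cs} → Walk (3 * n) 0 0 (as , bs , cs) → length as ≡ n × length bs ≡ n × length cs ≡ n
Walk-lengths {n} {as} {bs} {cs} w = len-a , trans (sym len-b) len-a , trans (sym len-c) len-a
  where
  open Valid (Walk⇒Valid w)
  open ≡.≡-Reasoning
  len-a : length as ≡ n
  len-a = ℕₚ.*-cancelˡ-≡ (length as) n 3 (begin
    length as + (length as + (length as + 0))
      ≡⟨ cong₂ (λ b c → length as + (b + c)) len-b (trans (ℕₚ.+-identityʳ _) len-c) ⟩
    length as + (length bs + length cs)
      ≡⟨ cong (λ l → length as + l) (Listₚ.length-++ bs) ⟨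
    length as + length (bs ++ cs)
      ≡⟨ Listₚ.length-++ as ⟨
    length (as ++ bs ++ cs)
      ≡⟨ ↭ₚ.↭-length perm ⟩
    length (applyDownFrom suc (3 * n))
      ≡⟨ Listₚ.length-applyDownFrom suc (3 * n) ⟩
    3 * n ∎)

-- Enumeration of the increasing forests.

fromForest-toForest-∈ : ∀ n {s} → s ∈ states (3 * n) 0 0 → fromForest (toForest n s) ≡ s
fromForest-toForest-∈ n s∈ with a , b , c ← Walk-lengths {n} (∈⇒Walk (3 * n) 0 0 s∈) = fromForest-toForest a b c

forests : ∀ n → List (Forest n)
forests n = map (toForest n) (states (3 * n) 0 0)

-- Mapping `fromForest` over the forests gives back the duplicate-free list of states, and a list
-- whose image has no repetition has none itself.
forests-unique : ∀ n → Unique (forests n)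
forests-unique n = Uniqueₚ.map⁻ (subst Unique (sym restored) (states-unique (3 * n) 0 0))
  where
  restored : map fromForest (forests n) ≡ states (3 * n) 0 0
  restored = trans (sym (Listₚ.map-∘ (states (3 * n) 0 0)))
    (Listₚ.map-id-local (All.tabulate (fromForest-toForest-∈ n)))

∈-forests : ∀ n F → F ∈ forests n ⇔ IsILF n F
∈-forests n F = mk⇔ sound complete
  where
  sound : F ∈ forests n → IsILF n F
  sound F∈ with s , s∈ , refl ← ∈-map⁻ (toForest n) F∈ =
    Walk⇒IsILF F (subst (Walk (3 * n) 0 0) (sym (fromForest-toForest-∈ n s∈)) (∈⇒Walk (3 * n) 0 0 s∈))
  complete : IsILF n F → F ∈ forests n
  complete ilf = subst (_∈ forests n) (toForest-fromForest F) (∈-map⁺ (toForest n) (Walk⇒∈ (IsILF⇒Walk F ilf)))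

length-forests : ∀ n → length (forests n) * ((n + 1) ! * (2 * n + 1) !) ≡ 4 ^ n * (3 * n) !
length-forests n = begin
  length (forests n) * ((n + 1) ! * (2 * n + 1) !)
    ≡⟨ cong₂ (λ l d → l * ((n + 1) ! * (d + 1) !))
         (trans (Listₚ.length-map _ (states (3 * n) 0 0)) (length-states (3 * n) 0 0)) (ℕₚ.*-comm 2 n) ⟩
  walks (3 * n) 0 0 * ((n + 1) ! * (n * 2 + 1) !)
    ≡⟨ cong (λ m → walks m 0 0 * ((n + 1) ! * (n * 2 + 1) !)) (ℕₚ.*-comm 3 n) ⟩
  walks (n * 3) 0 0 * ((n + 1) ! * (n * 2 + 1) !)
    ≡⟨ excursions-closed n ⟩
  4 ^ n * (n * 3) !
    ≡⟨ cong (λ m → 4 ^ n * m !) (ℕₚ.*-comm n 3) ⟩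
  4 ^ n * (3 * n) ! ∎
  where open ≡.≡-Reasoning

theorem3 : (n : ℕ) → 1 ≤ n →
    Σ (List (Forest n)) λ xs →
    Unique xs × (∀ F → (F ∈ xs) ⇔ IsILF n F) ×
    (length xs * ((n + 1) ! * (2 * n + 1) !) ≡ 4 ^ n * (3 * n) !)
theorem3 n _ = forests n , forests-unique n , ∈-forests n , length-forests n
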